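{- Let $k \ge 1$ and $k \le m < 2k$. The number of biGrassmannian permutations of $[m]$ that avoid $\operatorname{id}_k = 12\cdots k$ is $\binom{2k-m+1}{3}$.
   Context: A permutation is Grassmannian if it has at most one descent (one-line notation); it is biGrassmannian if both it and its inverse are Grassmannian. A permutation avoids $12\cdots k$ if it has no increasing subsequence of length $k$. -}

module Defs where

open import Data.Fin.Base using (Fin; toℕ; _<_)
open import Data.Fin.Permutation using (Permutation′; _⟨$⟩ʳ_; flip)
open import Data.Nat.Base using (ℕ; suc)
open import Data.Product.Base using (Σ; ∃-syntax; _×_; proj₁)
open import Function.Base using (_∘_)
open import Function.Bundles using (Inverse)
open import Level using (Level; 0ℓ; _⊔_)
open import Relation.Binary.Bundles using (Setoid)
open import Relation.Binary.Core using (_Preserves_⟶_)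
open import Relation.Binary.PropositionalEquality using (_≡_; setoid; _→-setoid_)
open import Relation.Nullary.Negation using (¬_)
import Relation.Binary.Construct.On as On

-- Fin m = {0, …, m-1} stands for [m], with its usual order.

Descent : ∀ {m} → Permutation′ m → Fin m → Set
Descent π i = ∃[ j ] (toℕ j ≡ suc (toℕ i) × (π ⟨$⟩ʳ j) < (π ⟨$⟩ʳ i))

Grassmannian : ∀ {m} → Permutation′ m → Set
Grassmannian π = ∀ i j → Descent π i → Descent π j → i ≡ j

BiGrassmannian : ∀ {m} → Permutation′ m → Set
BiGrassmannian π = Grassmannian π × Grassmannian (flip π)

-- f lists the positions, from left to right, of the chosen entries.
IncreasingSubsequence : ∀ {m} → ℕ → Permutation′ m → Set
IncreasingSubsequence {m} k π =
  Σ (Fin k → Fin m) λ f →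
    (f Preserves _<_ ⟶ _<_) × (((π ⟨$⟩ʳ_) ∘ f) Preserves _<_ ⟶ _<_)

AvoidsId : ∀ {m} → ℕ → Permutation′ m → Set
AvoidsId k π = ¬ IncreasingSubsequence k π

-- Two elements are identified when the underlying permutations agree
-- pointwise, so neither the proofs of the defining properties nor the
-- inverse-law proofs inside a permutation affect the count.
BiGrassmannianAvoidingId : ℕ → ℕ → Setoid 0ℓ 0ℓ
BiGrassmannianAvoidingId m k =
  On.setoid {B = Σ (Permutation′ m) λ π → BiGrassmannian π × AvoidsId k π}
    (Fin m →-setoid Fin m) ((_⟨$⟩ʳ_) ∘ proj₁)

HasCardinality : ∀ {a ℓ : Level} → Setoid a ℓ → ℕ → Set (a ⊔ ℓ)
HasCardinality S n = Inverse S (setoid (Fin n))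

{-# OPTIONS --safe #-}
module Submission where

-- A biGrassmannian permutation other than the identity fixes the first a
-- positions, exchanges two adjacent nonempty blocks of lengths b and c, and
-- fixes everything after them: if f descends from p to 1 + p and its inverse
-- g from q to 1 + q, then a = f (1 + p) = g (1 + q), and monotonicity of f and
-- g away from their descents forces all remaining values.  An increasing
-- subsequence misses one of the two blocks, so the longest one has length
-- m - min (b , c), and id_k is avoided iff b and c both exceed e = m - k.
-- Writing b = 1 + e + b′ and c = 1 + e + c′, it remains to count the triples
-- (a , b′ , c′) with sum at most 2k - m - 2, which Pascal's rule does.

open import Defs
open import Data.Nat.Base using (ℕ; zero; suc; _+_; _*_; _∸_; _≤_; _<_; z≤n; s≤s; z<s)
open import Data.Nat.Combinatorics using (_C_; nCk+nC[k+1]≡[n+1]C[k+1])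
open import Data.Nat.Properties
open import Data.Nat.Tactic.RingSolver using (solve-∀)
open import Data.Empty using (⊥-elim)
open import Data.Fin.Base using (Fin; toℕ; fromℕ<; splitAt)
open import Data.Fin.Permutation using (Permutation′; _⟨$⟩ʳ_; flip; permutation; inverseˡ; inverseʳ)
open import Data.Fin.Properties using (toℕ<n; toℕ-fromℕ<; toℕ-injective; any?; injective⇒≤; 1↔⊤; +↔⊎)
import Data.Fin.Properties as Fin
open import Data.Product.Base using (Σ; ∃; ∃-syntax; _×_; _,_; proj₁; proj₂)
open import Data.Sum.Base using (_⊎_; inj₁; inj₂; [_,_]′)
open import Data.Sum.Function.Propositional using (_⊎-↔_)
open import Data.Unit.Base using (tt)
open import Data.Vec.Base using (Vec; []; _∷_; sum)
open import Function.Base using (_∘_)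
open import Function.Bundles using (_↔_; Injection; Inverse; mk↔ₛ′)
open import Function.Properties.Inverse using (↔-sym; ↔-trans; ↔⇒↣)
open import Relation.Binary.Bundles using (Setoid)
open import Relation.Binary.Definitions using (tri<; tri≈; tri>)
open import Relation.Binary.PropositionalEquality
open import Relation.Nullary using (¬_; Dec; yes; no; contradiction)
open import Relation.Nullary.Decidable using (_×-dec_)

-- Increasing stretches of functions on ℕ

module _ (f : ℕ → ℕ) {l h : ℕ} (step : ∀ i → l ≤ i → i < h → f i < f (suc i)) where

  steps⇒increasing : ∀ {i j} → l ≤ i → i < j → j ≤ h → f i < f j
  steps⇒increasing {j = suc j} l≤i (s≤s i≤j) j<h with m≤n⇒m<n∨m≡n i≤j
  ... | inj₁ i<j  = <-trans (steps⇒increasing l≤i i<j (<⇒≤ j<h)) (step j (≤-trans l≤i i≤j) j<h)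
  ... | inj₂ refl = step j l≤i j<h

  -- Every strict step gains at least one. Below, this linear bound for a permutation is played off
  -- against the same bound for its inverse.
  steps⇒growth : ∀ j → l + j ≤ h → f l + j ≤ f (l + j)
  steps⇒growth zero    _ rewrite +-identityʳ l | +-identityʳ (f l) = ≤-refl
  steps⇒growth (suc j) p rewrite +-suc l j | +-suc (f l) j =
    ≤-<-trans (steps⇒growth j (<⇒≤ p)) (step (l + j) (m≤m+n l j) p)

-- Block swaps

-- Positions are written as offsets into the blocks, so no truncated subtraction occurs, and passing
-- to the inverse merely exchanges `b` and `c`.
record IsBlockSwap (a b c : ℕ) (f : ℕ → ℕ) : Set where
  field
    low  : ∀ {i} → i < a → f i ≡ i
    up   : ∀ {j} → j < b → f (a + j) ≡ a + c + j
    down : ∀ {j} → j < c → f (a + b + j) ≡ a + j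
    high : ∀ {i} → a + b + c ≤ i → f i ≡ i

data Zone (a b c : ℕ) : ℕ → Set where
  before : ∀ {i} → i < a → Zone a b c i
  first  : ∀ {j} → j < b → Zone a b c (a + j)
  second : ∀ {j} → j < c → Zone a b c (a + b + j)
  after  : ∀ {i} → a + b + c ≤ i → Zone a b c i

zone : ∀ a b c i → Zone a b c i
zone a b c i with i <? a
... | yes i<a = before i<a
... | no i≮a with m≤n⇒∃[o]m+o≡n (≮⇒≥ i≮a)
...   | j , refl with j <? b
...     | yes j<b = first j<b
...     | no j≮b with m≤n⇒∃[o]m+o≡n (≮⇒≥ j≮b)
...       | j′ , refl with j′ <? c
...         | yes j′<c = subst (Zone a b c) (+-assoc a b j′) (second j′<c)
...         | no j′≮c  = after (≤-trans (+-monoʳ-≤ (a + b) (≮⇒≥ j′≮c)) (≤-reflexive (+-assoc a b j′)))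

blockSwap : ℕ → ℕ → ℕ → ℕ → ℕ
blockSwap a b c i with i <? a
... | yes _ = i
... | no _ with i <? a + b
...   | yes _ = i + c
...   | no _ with i <? a + b + c
...     | yes _ = i ∸ b
...     | no _  = i

+-right-comm : ∀ a b c → a + b + c ≡ a + c + b
+-right-comm = solve-∀

blockSwap-isBlockSwap : ∀ a b c → IsBlockSwap a b c (blockSwap a b c)
blockSwap-isBlockSwap a b c = record { low = low ; up = up ; down = down ; high = high }
  where
  low : ∀ {i} → i < a → blockSwap a b c i ≡ i
  low {i} i<a with i <? a
  ... | yes _  = refl
  ... | no i≮a = contradiction i<a i≮a
  up : ∀ {j} → j < b → blockSwap a b c (a + j) ≡ a + c + j
  up {j} j<b with a + j <? a
  ... | yes p = contradiction p (m+n≮m a j)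
  ... | no _ with a + j <? a + b
  ...   | yes _ = +-right-comm a j c
  ...   | no p  = contradiction (+-monoʳ-< a j<b) p
  down : ∀ {j} → j < c → blockSwap a b c (a + b + j) ≡ a + j
  down {j} j<c with a + b + j <? a
  ... | yes p = contradiction (≤-<-trans (m≤m+n a b) (≤-<-trans (m≤m+n (a + b) j) p)) (n≮n a)
  ... | no _ with a + b + j <? a + b
  ...   | yes p = contradiction p (m+n≮m (a + b) j)
  ...   | no _ with a + b + j <? a + b + c
  ...     | yes _ = trans (cong (_∸ b) (+-right-comm a b j)) (m+n∸n≡m (a + j) b)
  ...     | no p  = contradiction (+-monoʳ-< (a + b) j<c) p
  high : ∀ {i} → a + b + c ≤ i → blockSwap a b c i ≡ i
  high {i} s≤i with i <? a
  ... | yes _ = refl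
  ... | no _ with i <? a + b
  ...   | yes p = contradiction (<-≤-trans p (≤-trans (m≤m+n (a + b) c) s≤i)) (n≮n i)
  ...   | no _ with i <? a + b + c
  ...     | yes p = contradiction (<-≤-trans p s≤i) (n≮n i)
  ...     | no _  = refl

IsBlockSwap-resp-≗ : ∀ {a b c f g} → f ≗ g → IsBlockSwap a b c f → IsBlockSwap a b c g
IsBlockSwap-resp-≗ f≗g F = record
  { low  = λ p → trans (sym (f≗g _)) (low p)
  ; up   = λ p → trans (sym (f≗g _)) (up p)
  ; down = λ p → trans (sym (f≗g _)) (down p)
  ; high = λ p → trans (sym (f≗g _)) (high p)
  } where open IsBlockSwap F

IsBlockSwap-unique : ∀ {a b c f g} → IsBlockSwap a b c f → IsBlockSwap a b c g → f ≗ g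
IsBlockSwap-unique {a} {b} {c} F G i with zone a b c i
... | before p = trans (F .IsBlockSwap.low p) (sym (G .IsBlockSwap.low p))
... | first p  = trans (F .IsBlockSwap.up p) (sym (G .IsBlockSwap.up p))
... | second p = trans (F .IsBlockSwap.down p) (sym (G .IsBlockSwap.down p))
... | after p  = trans (F .IsBlockSwap.high p) (sym (G .IsBlockSwap.high p))

-- Each zone of `g` lands in the zone of `f` that moves it back; the two middle zones trade places.
IsBlockSwap-inverse : ∀ {a b c f g} → IsBlockSwap a b c f → IsBlockSwap a c b g → ∀ i → f (g i) ≡ i
IsBlockSwap-inverse {a} {b} {c} {f} F G i with zone a c b i
... | before p = trans (cong f (G .IsBlockSwap.low p)) (F .IsBlockSwap.low p)
... | first p  = trans (cong f (G .IsBlockSwap.up p)) (F .IsBlockSwap.down p)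
... | second p = trans (cong f (G .IsBlockSwap.down p)) (F .IsBlockSwap.up p)
... | after p  = trans (cong f (G .IsBlockSwap.high p))
                       (F .IsBlockSwap.high (≤-trans (≤-reflexive (+-right-comm a b c)) p))

-- Monotonicity and the descent of a block swap

module BlockSwap {a b c f} (F : IsBlockSwap a b c f) where
  open IsBlockSwap F

  bounded : ∀ {m i} → a + b + c ≤ m → i < m → f i < m
  bounded {m} {i} s≤m i<m with zone a b c i
  ... | before p rewrite low p = i<m
  ... | first {j} p rewrite up p = begin-strict
    a + c + j <⟨ +-monoʳ-< (a + c) p ⟩
    a + c + b ≡⟨ +-right-comm a c b ⟩
    a + b + c ≤⟨ s≤m ⟩
    m         ∎ where open ≤-Reasoning
  ... | second {j} p rewrite down p = ≤-<-trans (+-monoˡ-≤ j (m≤m+n a b)) i<m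
  ... | after p rewrite high p = i<m

  increasing-before : ∀ {i j} → i < j → j < a + b → f i < f j
  increasing-before {i} {j} i<j j<a+b with j <? a
  ... | yes j<a rewrite low j<a | low (<-trans i<j j<a) = i<j
  ... | no j≮a with m≤n⇒∃[o]m+o≡n (≮⇒≥ j≮a)
  ...   | j′ , refl with i <? a
  ...     | yes i<a rewrite low i<a | up (+-cancelˡ-< a j′ b j<a+b) =
              <-≤-trans i<a (≤-trans (m≤m+n a c) (m≤m+n (a + c) j′))
  ...     | no i≮a with m≤n⇒∃[o]m+o≡n (≮⇒≥ i≮a)
  ...       | i′ , refl rewrite up (+-cancelˡ-< a j′ b j<a+b)
                              | up (+-cancelˡ-< a i′ b (<-trans i<j j<a+b)) =
              +-monoʳ-< (a + c) (+-cancelˡ-< a i′ j′ i<j)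

  increasing-after : ∀ {i j} → a + b ≤ i → i < j → f i < f j
  increasing-after {i} {j} a+b≤i i<j with m≤n⇒∃[o]m+o≡n a+b≤i
  ... | i′ , refl with i′ <? c
  ...   | no i′≮c rewrite high (+-monoʳ-≤ (a + b) (≮⇒≥ i′≮c))
                        | high (≤-trans (+-monoʳ-≤ (a + b) (≮⇒≥ i′≮c)) (<⇒≤ i<j)) = i<j
  ...   | yes i′<c with m≤n⇒∃[o]m+o≡n (≤-trans a+b≤i (<⇒≤ i<j))
  ...     | j′ , refl with j′ <? c
  ...       | yes j′<c rewrite down i′<c | down j′<c = +-monoʳ-< a (+-cancelˡ-< (a + b) i′ j′ i<j)
  ...       | no j′≮c rewrite down i′<c | high (+-monoʳ-≤ (a + b) (≮⇒≥ j′≮c)) =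
                ≤-<-trans (+-monoˡ-≤ i′ (m≤m+n a b)) i<j

  -- `f` increases strictly on either side of the boundary between the two blocks, so only the step
  -- across it can go down.
  descent-position : ∀ {i} → f (suc i) < f i → suc i ≡ a + b
  descent-position {i} d with <-cmp (suc i) (a + b)
  ... | tri< p _ _ = contradiction d (<⇒≯ (increasing-before ≤-refl p))
  ... | tri≈ _ p _ = p
  ... | tri> _ _ p = contradiction d (<⇒≯ (increasing-after (≤-pred p) ≤-refl))

  f[a+b]≡a : 0 < c → f (a + b) ≡ a
  f[a+b]≡a 0<c = trans (cong f (sym (+-identityʳ (a + b)))) (trans (down 0<c) (+-identityʳ a))

  f[a]≡a+c : 0 < b → f a ≡ a + c
  f[a]≡a+c 0<b = trans (cong f (sym (+-identityʳ a))) (trans (up 0<b) (+-identityʳ (a + c)))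

  first⇒≥ : ∀ {i} → a ≤ i → i < a + b → a + c ≤ f i
  first⇒≥ a≤i i<a+b with m≤n⇒∃[o]m+o≡n a≤i
  ... | j , refl rewrite up (+-cancelˡ-< a j b i<a+b) = m≤m+n (a + c) j

  second⇒< : ∀ {i} → a + b ≤ i → i < a + b + c → f i < a + c
  second⇒< a+b≤i i<s with m≤n⇒∃[o]m+o≡n a+b≤i
  ... | j , refl with +-cancelˡ-< (a + b) j c i<s
  ...   | j<c rewrite down j<c = +-monoʳ-< a j<c

  has-descent : 0 < b → 0 < c → ∃[ i ] (suc i ≡ a + b × f (suc i) < f i)
  has-descent (s≤s {n = b′} _) 0<c = a + b′ , sym (+-suc a b′) , (begin-strict
    f (suc (a + b′)) ≡⟨ cong f (sym (+-suc a b′)) ⟩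
    f (a + b)        ≡⟨ f[a+b]≡a 0<c ⟩
    a                <⟨ m<m+n a 0<c ⟩
    a + c            ≤⟨ first⇒≥ (m≤m+n a b′) (+-monoʳ-< a ≤-refl) ⟩
    f (a + b′)       ∎) where open ≤-Reasoning

  a≤f[i] : ∀ {i} → a + b ≤ i → a ≤ f i
  a≤f[i] a+b≤i with m≤n⇒∃[o]m+o≡n a+b≤i
  ... | j , refl with j <? c
  ...   | yes j<c rewrite down j<c = m≤m+n a j
  ...   | no j≮c rewrite high (+-monoʳ-≤ (a + b) (≮⇒≥ j≮c)) = ≤-trans (m≤m+n a b) a+b≤i

-- For nonempty blocks the descent ends at position `a + b`, the value there is `a`, and the value
-- at `a` is `a + c`; so `f` determines all three parameters.
IsBlockSwap-injective : ∀ {a b c a′ b′ c′ f} → 0 < b → 0 < c → 0 < b′ → 0 < c′ →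
  IsBlockSwap a b c f → IsBlockSwap a′ b′ c′ f → a ≡ a′ × b ≡ b′ × c ≡ c′
IsBlockSwap-injective {a} {b} {c} {a′} {b′} {c′} {f} 0<b 0<c 0<b′ 0<c′ F F′
  with F.has-descent 0<b 0<c
  where module F = BlockSwap F
... | i , i≡ , d = a≡a′ , b≡b′ , c≡c′
  where
  module F = BlockSwap F
  module F′ = BlockSwap F′
  ab≡ : a + b ≡ a′ + b′
  ab≡ = trans (sym i≡) (F′.descent-position d)
  a≡a′ : a ≡ a′
  a≡a′ = trans (sym (F.f[a+b]≡a 0<c)) (trans (cong f ab≡) (F′.f[a+b]≡a 0<c′))
  b≡b′ : b ≡ b′
  b≡b′ = +-cancelˡ-≡ a b b′ (trans ab≡ (cong (_+ b′) (sym a≡a′)))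
  c≡c′ : c ≡ c′
  c≡c′ = +-cancelˡ-≡ a c c′ (trans (sym (F.f[a]≡a+c 0<b))
           (trans (cong f a≡a′) (trans (F′.f[a]≡a+c 0<b′) (cong (_+ c′) (sym a≡a′)))))

-- Classification of biGrassmannian permutations

-- The data are symmetric under exchanging `(f , p)` with `(g , q)`, so through `swapped` each lemma
-- below also holds for the inverse.
record BiGrassmannianPair (f g : ℕ → ℕ) (p q : ℕ) : Set where
  field
    fg        : ∀ i → f (g i) ≡ i
    gf        : ∀ i → g (f i) ≡ i
    f-descent : f (suc p) < f p
    g-descent : g (suc q) < g q
    f-step    : ∀ {i} → i ≢ p → f i < f (suc i)
    g-step    : ∀ {i} → i ≢ q → g i < g (suc i)

  f-injective : ∀ {i j} → f i ≡ f j → i ≡ j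
  f-injective {i} {j} eq = trans (sym (gf i)) (trans (cong g eq) (gf j))

  step≤p : ∀ i {l} → l ≤ i → i < p → f i < f (suc i)
  step≤p _ _ i<p = f-step (<⇒≢ i<p)

  step>p : ∀ {l} → p < l → ∀ i → l ≤ i → ∀ {h} → i < h → f i < f (suc i)
  step>p p<l _ l≤i _ = f-step (>⇒≢ (<-≤-trans p<l l≤i))

  increasing>p : ∀ {i j} → p < i → i < j → f i < f j
  increasing>p p<i i<j = steps⇒increasing f (λ i l≤i i<h → step>p p<i i l≤i i<h) ≤-refl i<j ≤-refl

  growth≤p : ∀ {l} j → l + j ≤ p → f l + j ≤ f (l + j)
  growth≤p = steps⇒growth f (λ i → step≤p i)

  growth>p : ∀ {l} → p < l → ∀ j → f l + j ≤ f (l + j)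
  growth>p p<l j = steps⇒growth f (λ i l≤i i<h → step>p p<l i l≤i i<h) j ≤-refl

  i≤f[i] : ∀ {i} → i ≤ p → i ≤ f i
  i≤f[i] {i} i≤p = ≤-trans (m≤n+m i (f 0)) (growth≤p i i≤p)

swapped : ∀ {f g p q} → BiGrassmannianPair f g p q → BiGrassmannianPair g f q p
swapped B = record
  { fg = gf ; gf = fg ; f-descent = g-descent ; g-descent = f-descent
  ; f-step = g-step ; g-step = f-step } where open BiGrassmannianPair B

module _ {f g p q} (B : BiGrassmannianPair f g p q) where
  open BiGrassmannianPair B
  private module G = BiGrassmannianPair (swapped B)

  -- The values `f (1 + p) < f p` form an inversion of `g`. If both lay beyond `q`, where `g`
  -- increases, then `1 + p < p` would follow.
  f[1+p]≤q : f (suc p) ≤ q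
  f[1+p]≤q = ≮⇒≥ λ q<f[1+p] → <-asym ≤-refl
    (subst₂ _<_ (gf (suc p)) (gf p) (G.increasing>p q<f[1+p] f-descent))

  -- Beyond `p` all values of `f` are at least `f (1 + p)`, so `g v` is at most `p`. There `f` does
  -- not lower its argument, giving `g v ≤ v`; since `v ≤ q`, the same property of `g` gives
  -- `v ≤ g v`.
  g-fixes : ∀ {v} → v < f (suc p) → g v ≡ v
  g-fixes {v} v<a = ≤-antisym
      (≤-trans (i≤f[i] (≮⇒≥ p≮gv)) (≤-reflexive (fg v)))
      (G.i≤f[i] (≤-trans (<⇒≤ v<a) f[1+p]≤q))
    where
    p≮gv : ¬ p < g v
    p≮gv p<gv with m≤n⇒m<n∨m≡n p<gv
    ... | inj₁ lt = <-asym v<a (subst (f (suc p) <_) (fg v) (increasing>p ≤-refl lt))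
    ... | inj₂ eq = <-irrefl (sym (trans (cong f eq) (fg v))) v<a

-- Otherwise `f` would fix its own value `f (1 + p)`, hence also `1 + p` by injectivity, although
-- `f (1 + p) < g (1 + q) ≤ p`.
f[1+p]≮g[1+q] : ∀ {f g p q} → BiGrassmannianPair f g p q → ¬ f (suc p) < g (suc q)
f[1+p]≮g[1+q] {p = p} B lt =
  <-irrefl (f-injective (g-fixes (swapped B) lt))
           (s≤s (≤-trans (<⇒≤ lt) (f[1+p]≤q (swapped B))))
  where open BiGrassmannianPair B

f[1+p]≡g[1+q] : ∀ {f g p q} → BiGrassmannianPair f g p q → f (suc p) ≡ g (suc q)
f[1+p]≡g[1+q] B = ≤-antisym (≮⇒≥ (f[1+p]≮g[1+q] (swapped B))) (≮⇒≥ (f[1+p]≮g[1+q] B))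

module _ {f g p q} (B : BiGrassmannianPair f g p q) where
  open BiGrassmannianPair B
  private module G = BiGrassmannianPair (swapped B)

  -- f grows at least linearly on the block [a , p] and g on the block
  -- starting at its image 1 + q, and the two bounds force equality.
  f-on-first : ∀ {a j} → a ≡ f (suc p) → a + j ≤ p → f (a + j) ≡ suc q + j
  f-on-first {a} {j} a≡ a+j≤p = trans (sym eq) (cong (suc q +_) (≤-antisym i≤j j≤i))
    where
    f[a]≡1+q : f a ≡ suc q
    f[a]≡1+q = trans (cong f (trans a≡ (f[1+p]≡g[1+q] B))) (fg (suc q))
    lower : suc q + j ≤ f (a + j)
    lower = subst (λ x → x + j ≤ f (a + j)) f[a]≡1+q (growth≤p j a+j≤p)
    split : ∃[ i ] suc q + i ≡ f (a + j)
    split = m≤n⇒∃[o]m+o≡n (≤-trans (m≤m+n (suc q) j) lower)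
    i = proj₁ split
    eq : suc q + i ≡ f (a + j)
    eq = proj₂ split
    j≤i : j ≤ i
    j≤i = +-cancelˡ-≤ (suc q) j i (≤-trans lower (≤-reflexive (sym eq)))
    i≤j : i ≤ j
    i≤j = +-cancelˡ-≤ a i j (begin
      a + i           ≡⟨ cong (_+ i) (trans a≡ (f[1+p]≡g[1+q] B)) ⟩
      g (suc q) + i   ≤⟨ G.growth>p ≤-refl i ⟩
      g (suc q + i)   ≡⟨ cong g eq ⟩
      g (f (a + j))   ≡⟨ gf (a + j) ⟩
      a + j           ∎) where open ≤-Reasoning

  -- Growth beyond `p` reduces this to the position `a + b + c`. Its value is at least `1 + q`, and
  -- the values `1 + q + l` with `l < b` are already taken by the first block, so it is at least
  -- `1 + q + b`.
  i≤f[i]-above : ∀ {a b c} → a ≡ f (suc p) → a + b ≡ suc p → a + c ≡ suc q →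
                 ∀ {i} → a + b + c ≤ i → i ≤ f i
  i≤f[i]-above {a} {b} {c} a≡ ab≡ ac≡ {i} s≤i with m≤n⇒∃[o]m+o≡n s≤i
  ... | y , refl = ≤-trans (+-monoˡ-≤ y s≤f[s])
                           (growth>p (≤-trans (≤-reflexive (sym ab≡)) (m≤m+n (a + b) c)) y)
    where
    s = a + b + c
    open ≤-Reasoning
    1+q≤f[s] : suc q ≤ f s
    1+q≤f[s] = begin
      suc q         ≡⟨ sym ac≡ ⟩
      a + c         ≡⟨ cong (_+ c) a≡ ⟩
      f (suc p) + c ≤⟨ growth>p ≤-refl c ⟩
      f (suc p + c) ≡⟨ cong (λ x → f (x + c)) (sym ab≡) ⟩
      f s           ∎
    split : ∃[ l ] suc q + l ≡ f s
    split = m≤n⇒∃[o]m+o≡n 1+q≤f[s]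
    l = proj₁ split
    l≮b : ¬ l < b
    l≮b l<b = <-irrefl (f-injective (trans (f-on-first a≡ a+l≤p) (proj₂ split)))
                       (<-≤-trans (+-monoʳ-< a l<b) (m≤m+n (a + b) c))
      where
      a+l≤p : a + l ≤ p
      a+l≤p = ≤-pred (≤-trans (+-monoʳ-< a l<b) (≤-reflexive ab≡))
    s≤f[s] : s ≤ f s
    s≤f[s] = begin
      a + b + c ≡⟨ +-right-comm a b c ⟩
      a + c + b ≡⟨ cong (_+ b) ac≡ ⟩
      suc q + b ≤⟨ +-monoʳ-≤ (suc q) (≮⇒≥ l≮b) ⟩
      suc q + l ≡⟨ proj₂ split ⟩
      f s       ∎

biGrassmannianPair⇒blockSwap : ∀ {f g p q} → BiGrassmannianPair f g p q →
  ∃[ a ] ∃[ b ] ∃[ c ] (0 < b × 0 < c × IsBlockSwap a b c f)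
biGrassmannianPair⇒blockSwap {f} {g} {p} {q} B =
  a , suc b′ , suc c′ , z<s , z<s ,
  record { low = low ; up = up ; down = down ; high = high }
  where
  open BiGrassmannianPair B
  a = f (suc p)
  a≡ : a ≡ g (suc q)
  a≡ = f[1+p]≡g[1+q] B
  a≤p : ∃[ b ] a + b ≡ p
  a≤p = m≤n⇒∃[o]m+o≡n (≤-trans (≤-reflexive a≡) (f[1+p]≤q (swapped B)))
  a≤q : ∃[ c ] a + c ≡ q
  a≤q = m≤n⇒∃[o]m+o≡n (f[1+p]≤q B)
  b′ = proj₁ a≤p
  c′ = proj₁ a≤q
  ab≡ : a + suc b′ ≡ suc p
  ab≡ = trans (+-suc a b′) (cong suc (proj₂ a≤p))
  ac≡ : a + suc c′ ≡ suc q
  ac≡ = trans (+-suc a c′) (cong suc (proj₂ a≤q))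
  low : ∀ {i} → i < a → f i ≡ i
  low i<a = g-fixes (swapped B) (<-≤-trans i<a (≤-reflexive a≡))
  up : ∀ {j} → j < suc b′ → f (a + j) ≡ a + suc c′ + j
  up {j} j<b = trans (f-on-first B refl (≤-pred (≤-trans (+-monoʳ-< a j<b) (≤-reflexive ab≡))))
                     (cong (_+ j) (sym ac≡))
  -- The inverse moves its first block upwards as `f` does; applying `f` to that equation describes
  -- the second block of `f`.
  down : ∀ {j} → j < suc c′ → f (a + suc b′ + j) ≡ a + j
  down {j} j<c = trans (cong (λ x → f (x + j)) ab≡)
    (trans (cong f (sym (f-on-first (swapped B) a≡ (≤-pred (≤-trans (+-monoʳ-< a j<c) (≤-reflexive ac≡))))))
           (fg (a + j)))
  high : ∀ {i} → a + suc b′ + suc c′ ≤ i → f i ≡ i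
  -- The lower bound for `g`, taken at `f i`, reads `f i ≤ i`.
  high {i} s≤i = ≤-antisym
    (≤-trans (i≤f[i]-above (swapped B) a≡ ac≡ ab≡
               (≤-trans (≤-reflexive (+-right-comm a (suc c′) (suc b′))) (≤-trans s≤i i≤f[i]′)))
             (≤-reflexive (gf i)))
    i≤f[i]′
    where
    i≤f[i]′ : i ≤ f i
    i≤f[i]′ = i≤f[i]-above B refl ab≡ ac≡ s≤i

-- Permutations of Fin m as functions on ℕ

-- Continuing by the identity creates no new descent: the step into position `m` rises from a value
-- below `m` to `m` itself.
extend : ∀ {m} → (Fin m → Fin m) → ℕ → ℕ
extend {m} h i with i <? m
... | yes i<m = toℕ (h (fromℕ< i<m))
... | no _    = i

toℕ-or-≥ : ∀ m i → (∃ λ (j : Fin m) → toℕ j ≡ i) ⊎ m ≤ i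
toℕ-or-≥ m i with i <? m
... | yes i<m = inj₁ (fromℕ< i<m , toℕ-fromℕ< i<m)
... | no i≮m  = inj₂ (≮⇒≥ i≮m)

module _ {m} (h : Fin m → Fin m) where

  extend-toℕ : ∀ i → extend h (toℕ i) ≡ toℕ (h i)
  extend-toℕ i with toℕ i <? m
  ... | yes i<m = cong (toℕ ∘ h) (Fin.fromℕ<-toℕ i i<m)
  ... | no i≮m  = contradiction (toℕ<n i) i≮m

  extend-≥ : ∀ {i} → m ≤ i → extend h i ≡ i
  extend-≥ {i} m≤i with i <? m
  ... | yes i<m = contradiction i<m (≤⇒≯ m≤i)
  ... | no _    = refl

extend-cong : ∀ {m} {h h′ : Fin m → Fin m} → h ≗ h′ → extend h ≗ extend h′
extend-cong {m} {h} {h′} h≗h′ i with toℕ-or-≥ m i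
... | inj₁ (j , refl) = trans (extend-toℕ h j) (trans (cong toℕ (h≗h′ j)) (sym (extend-toℕ h′ j)))
... | inj₂ m≤i        = trans (extend-≥ h m≤i) (sym (extend-≥ h′ m≤i))

extend-inverse : ∀ {m} {h h′ : Fin m → Fin m} → (∀ i → h (h′ i) ≡ i) → ∀ i → extend h (extend h′ i) ≡ i
extend-inverse {m} {h} {h′} hh′ i with toℕ-or-≥ m i
... | inj₁ (j , refl) = trans (cong (extend h) (extend-toℕ h′ j))
                              (trans (extend-toℕ h (h′ j)) (cong toℕ (hh′ j)))
... | inj₂ m≤i        = trans (cong (extend h) (extend-≥ h′ m≤i)) (extend-≥ h m≤i)

apply : ∀ {m} → Permutation′ m → ℕ → ℕ
apply π = extend (π ⟨$⟩ʳ_)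

module _ {m} (π : Permutation′ m) where

  apply-flip : ∀ i → apply π (apply (flip π) i) ≡ i
  apply-flip = extend-inverse (λ _ → inverseʳ π)

  flip-apply : ∀ i → apply (flip π) (apply π i) ≡ i
  flip-apply = extend-inverse (λ _ → inverseˡ π)

  apply-injective : ∀ {i j} → apply π i ≡ apply π j → i ≡ j
  apply-injective {i} {j} eq =
    trans (sym (flip-apply i)) (trans (cong (apply (flip π)) eq) (flip-apply j))

  Descent⇒apply : ∀ {i} → Descent π i → apply π (suc (toℕ i)) < apply π (toℕ i)
  Descent⇒apply {i} (j , j≡ , d) =
    subst₂ _<_ (trans (sym (extend-toℕ _ j)) (cong (apply π) j≡)) (sym (extend-toℕ _ i)) d

  apply⇒Descent : ∀ {i} → apply π (suc i) < apply π i → ∃[ j ] (toℕ j ≡ i × Descent π j)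
  apply⇒Descent {i} d with toℕ-or-≥ m i | toℕ-or-≥ m (suc i)
  ... | inj₁ (j , refl) | inj₁ (j′ , j′≡) =
    j , refl , j′ , j′≡ ,
    subst₂ _<_ (trans (cong (apply π) (sym j′≡)) (extend-toℕ _ j′)) (extend-toℕ _ j) d
  ... | inj₁ (j , refl) | inj₂ m≤1+j =
    contradiction (subst₂ _<_ (extend-≥ _ m≤1+j) (extend-toℕ _ j) d)
                  (<⇒≯ (<-≤-trans (toℕ<n _) m≤1+j))
  ... | inj₂ m≤i | _ =
    contradiction (subst₂ _<_ (extend-≥ _ (m≤n⇒m≤1+n m≤i)) (extend-≥ _ m≤i) d) (<⇒≯ ≤-refl)

  ¬descent⇒step : ∀ {i} → ¬ apply π (suc i) < apply π i → apply π i < apply π (suc i)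
  ¬descent⇒step {i} ¬d = ≤∧≢⇒< (≮⇒≥ ¬d) (<⇒≢ (n<1+n i) ∘ apply-injective)

  Descent? : ∀ i → Dec (Descent π i)
  Descent? i = any? λ j → (toℕ j ≟ suc (toℕ i)) ×-dec ((π ⟨$⟩ʳ j) Fin.<? (π ⟨$⟩ʳ i))

  Grassmannian⇒step : ∀ {p} → Grassmannian π → Descent π p →
                      ∀ {i} → i ≢ toℕ p → apply π i < apply π (suc i)
  Grassmannian⇒step {p} gr dp i≢p = ¬descent⇒step λ d →
    let j , j≡i , dj = apply⇒Descent d in i≢p (trans (sym j≡i) (cong toℕ (gr j p dj dp)))

  no-Descent⇒increasing : ¬ ∃ (Descent π) → ∀ {i j} → i < j → apply π i < apply π j
  no-Descent⇒increasing ¬d i<j =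
    steps⇒increasing (apply π)
      (λ _ _ _ → ¬descent⇒step λ d → let j , _ , dj = apply⇒Descent d in ¬d (j , dj))
      z≤n i<j ≤-refl

  increasingSubsequence : ∀ {k} (φ : ℕ → ℕ) → (∀ {i} → i < k → φ i < m) →
    (∀ {i j} → i < j → φ i < φ j) → (∀ {i j} → i < j → apply π (φ i) < apply π (φ j)) →
    IncreasingSubsequence k π
  increasingSubsequence {k} φ φ<m φ-mono πφ-mono =
    at ,
    (λ i<j → subst₂ _<_ (sym (toℕ-at _)) (sym (toℕ-at _)) (φ-mono i<j)) ,
    (λ i<j → subst₂ _<_ (apply-at _) (apply-at _) (πφ-mono i<j))
    where
    at : Fin k → Fin m
    at i = fromℕ< (φ<m (toℕ<n i))
    toℕ-at : ∀ i → toℕ (at i) ≡ φ (toℕ i)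
    toℕ-at i = toℕ-fromℕ< (φ<m (toℕ<n i))
    apply-at : ∀ i → apply π (φ (toℕ i)) ≡ toℕ (π ⟨$⟩ʳ at i)
    apply-at i = trans (cong (apply π) (sym (toℕ-at i))) (extend-toℕ _ (at i))

-- Increasing subsequences of block swaps

-- The increasing enumeration of the naturals outside the interval from `s` up to but excluding
-- `s + l`.
skip : ℕ → ℕ → ℕ → ℕ
skip s l i with i <? s
... | yes _ = i
... | no _  = i + l

skip-≤ : ∀ s l i → skip s l i ≤ i + l
skip-≤ s l i with i <? s
... | yes _ = m≤m+n i l
... | no _  = ≤-refl

-- Serves twice for each subsequence: with the identity for the positions and with `apply π` for the
-- values.
skip-transport : ∀ s l (f : ℕ → ℕ) →
  (∀ {i j} → i < j → j < s → f i < f j) →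
  (∀ {i j} → i < s → s + l ≤ j → f i < f j) →
  (∀ {i j} → s + l ≤ i → i < j → f i < f j) →
  ∀ {i j} → i < j → f (skip s l i) < f (skip s l j)
skip-transport s l f lo mid hi {i} {j} i<j with i <? s | j <? s
... | yes _   | yes j<s = lo i<j j<s
... | yes i<s | no j≮s  = mid i<s (+-monoˡ-≤ l (≮⇒≥ j≮s))
... | no i≮s  | yes j<s = contradiction (<-trans i<j j<s) i≮s
... | no i≮s  | no _    = hi (+-monoˡ-≤ l (≮⇒≥ i≮s)) (+-monoˡ-< l i<j)

skip-mono-< : ∀ s l {i j} → i < j → skip s l i < skip s l j
skip-mono-< s l = skip-transport s l (λ i → i) (λ i<j _ → i<j)
  (λ i<s s+l≤j → <-≤-trans i<s (≤-trans (m≤m+n s l) s+l≤j)) (λ _ i<j → i<j)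

increasing⇒injective : ∀ {k} (h : Fin k → ℕ) → (∀ {i j} → toℕ i < toℕ j → h i < h j) →
                       ∀ {i j} → h i ≡ h j → i ≡ j
increasing⇒injective h h-mono {i} {j} eq with Fin.<-cmp i j
... | tri< i<j _ _ = contradiction eq (<⇒≢ (h-mono i<j))
... | tri≈ _ i≡j _ = i≡j
... | tri> _ _ j<i = contradiction eq (>⇒≢ (h-mono j<i))

-- The values of `h` and the elements of the block are disjoint, so together they inject
-- `Fin k ⊎ Fin l` into `Fin m`.
misses-block⇒≤ : ∀ {k m s l} (h : Fin k → ℕ) → (∀ {i j} → h i ≡ h j → i ≡ j) → (∀ i → h i < m) →
  s + l ≤ m → (∀ i → ¬ (s ≤ h i × h i < s + l)) → k + l ≤ m
misses-block⇒≤ {k} {m} {s} {l} h h-inj h<m s+l≤m misses = injective⇒≤ λ {x} {y} eq →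
  Injection.injective (↔⇒↣ +↔⊎) (place-injective (splitAt k x) (splitAt k y) eq)
  where
  place : Fin k ⊎ Fin l → Fin m
  place (inj₁ i) = fromℕ< (h<m i)
  place (inj₂ j) = fromℕ< (<-≤-trans (+-monoʳ-< s (toℕ<n j)) s+l≤m)
  hit : ∀ {i j} → h i ≢ s + toℕ j
  hit {i} {j} eq = misses i
    (subst (λ x → s ≤ x × x < s + l) (sym eq) (m≤m+n s (toℕ j) , +-monoʳ-< s (toℕ<n j)))
  place-injective : ∀ x y → place x ≡ place y → x ≡ y
  place-injective (inj₁ i) (inj₁ j) eq = cong inj₁ (h-inj (Fin.fromℕ<-injective _ _ _ _ eq))
  place-injective (inj₁ i) (inj₂ j) eq = contradiction (Fin.fromℕ<-injective _ _ _ _ eq) hit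
  place-injective (inj₂ i) (inj₁ j) eq = contradiction (sym (Fin.fromℕ<-injective _ _ _ _ eq)) hit
  place-injective (inj₂ i) (inj₂ j) eq =
    cong inj₂ (toℕ-injective (+-cancelˡ-≡ s _ _ (Fin.fromℕ<-injective _ _ _ _ eq)))

module _ {m a b c} (π : Permutation′ m) (F : IsBlockSwap a b c (apply π)) where
  open IsBlockSwap F
  open BlockSwap F

  blockSwap-Grassmannian : Grassmannian π
  blockSwap-Grassmannian i j di dj = toℕ-injective (suc-injective
    (trans (descent-position (Descent⇒apply π di)) (sym (descent-position (Descent⇒apply π dj)))))

  -- Without the first block the remaining entries increase, and the first `k` remaining positions
  -- lie below `k + b`.
  skip-first : ∀ {k} → k + b ≤ m → IncreasingSubsequence k π
  skip-first k+b≤m = increasingSubsequence π (skip a b)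
    (λ {i} i<k → ≤-<-trans (skip-≤ a b i) (<-≤-trans (+-monoˡ-< b i<k) k+b≤m))
    (skip-mono-< a b)
    (skip-transport a b (apply π)
      (λ i<j j<a → increasing-before i<j (<-≤-trans j<a (m≤m+n a b)))
      (λ i<a a+b≤j → ≤-<-trans (≤-reflexive (low i<a)) (<-≤-trans i<a (a≤f[i] a+b≤j)))
      increasing-after)

  skip-second : ∀ {k} → k + c ≤ m → IncreasingSubsequence k π
  skip-second k+c≤m = increasingSubsequence π (skip (a + b) c)
    (λ {i} i<k → ≤-<-trans (skip-≤ (a + b) c i) (<-≤-trans (+-monoˡ-< c i<k) k+c≤m))
    (skip-mono-< (a + b) c)
    (skip-transport (a + b) c (apply π)
      increasing-before
      -- Positions below `a + b + c` are permuted among themselves, and all later ones are fixed.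
      (λ i<a+b s≤j → <-≤-trans (bounded ≤-refl (<-≤-trans i<a+b (m≤m+n (a + b) c)))
                               (≤-trans s≤j (≤-reflexive (sym (high s≤j)))))
      (λ s≤i → increasing-after (≤-trans (m≤m+n (a + b) c) s≤i)))

  -- The entries of the first block all exceed those of the second, so an
  -- increasing subsequence misses one of the two blocks.
  increasing⇒≤ : ∀ {k} → a + b + c ≤ m → IncreasingSubsequence k π → k + b ≤ m ⊎ k + c ≤ m
  increasing⇒≤ {k} s≤m (h , h-mono , πh-mono)
    with any? (λ i → (a ≤? toℕ (h i)) ×-dec (toℕ (h i) <? a + b))
  ... | no ¬first = inj₁ (misses-block⇒≤ (toℕ ∘ h) (increasing⇒injective (toℕ ∘ h) h-mono) (λ i → toℕ<n (h i))
                            (≤-trans (m≤m+n (a + b) c) s≤m) (λ i p → ¬first (i , p)))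
  ... | yes (i₀ , a≤ , <a+b) = inj₂ (misses-block⇒≤ (toℕ ∘ h)
      (increasing⇒injective (toℕ ∘ h) h-mono) (λ i → toℕ<n (h i)) s≤m misses)
    where
    misses : ∀ i → ¬ (a + b ≤ toℕ (h i) × toℕ (h i) < a + b + c)
    misses i (≥a+b , <s) with Fin.<-cmp i i₀
    ... | tri< i<i₀ _ _ = <-asym (h-mono i<i₀) (<-≤-trans <a+b ≥a+b)
    ... | tri≈ _ refl _ = <⇒≱ <a+b ≥a+b
    ... | tri> _ _ i₀<i = <-asym (πh-mono i₀<i)
      (subst₂ _<_ (extend-toℕ _ (h i)) (extend-toℕ _ (h i₀))
        (<-≤-trans (second⇒< ≥a+b <s) (first⇒≥ a≤ <a+b)))

  -- Otherwise the last position of the second block is at least `m`, so the extension fixes it,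
  -- whereas the swap lowers it by `b`.
  blockSwap-fits : 0 < b → 0 < c → a + b + c ≤ m
  blockSwap-fits 0<b (s≤s {n = c′} _) = ≮⇒≥ λ m<s →
    <-irrefl (trans (sym (down ≤-refl)) (extend-≥ _ (≤-pred (<-≤-trans m<s (≤-reflexive (+-suc (a + b) c′))))))
             (+-monoˡ-< c′ (m<m+n a 0<b))

-- Permutations as block swaps and block swaps as permutations

classification : ∀ {m k} (π : Permutation′ m) → k ≤ m → BiGrassmannian π → AvoidsId k π →
  ∃[ a ] ∃[ b ] ∃[ c ] (0 < b × 0 < c × IsBlockSwap a b c (apply π))
classification π k≤m (gr , gr⁻¹) av with any? (Descent? π)
-- Without descents `π` is increasing, and its first `k` entries contradict avoidance.
... | no ¬d = contradiction
  (increasingSubsequence π (λ i → i) (λ i<k → <-≤-trans i<k k≤m) (λ i<j → i<j) (no-Descent⇒increasing π ¬d)) av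
... | yes (p , dp) with any? (Descent? (flip π))
-- An increasing inverse would turn the descent of `π` at `p` into `1 + p < p`.
...   | no ¬d = contradiction
  (subst₂ _<_ (flip-apply π _) (flip-apply π _) (no-Descent⇒increasing (flip π) ¬d (Descent⇒apply π dp)))
  (<⇒≯ ≤-refl)
...   | yes (q , dq) = biGrassmannianPair⇒blockSwap record
  { fg = apply-flip π ; gf = flip-apply π
  ; f-descent = Descent⇒apply π dp ; g-descent = Descent⇒apply (flip π) dq
  ; f-step = Grassmannian⇒step π gr dp ; g-step = Grassmannian⇒step (flip π) gr⁻¹ dq }

module _ {m} a b c (s≤m : a + b + c ≤ m) where

  blockSwapFin : Fin m → Fin m
  blockSwapFin i = fromℕ< (BlockSwap.bounded (blockSwap-isBlockSwap a b c) s≤m (toℕ<n i))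

  toℕ-blockSwapFin : ∀ i → toℕ (blockSwapFin i) ≡ blockSwap a b c (toℕ i)
  toℕ-blockSwapFin i = toℕ-fromℕ< _

  extend-blockSwapFin : IsBlockSwap a b c (extend blockSwapFin)
  extend-blockSwapFin = IsBlockSwap-resp-≗ agree (blockSwap-isBlockSwap a b c)
    where
    agree : blockSwap a b c ≗ extend blockSwapFin
    agree i with toℕ-or-≥ m i
    ... | inj₁ (j , refl) = sym (trans (extend-toℕ _ j) (toℕ-blockSwapFin j))
    ... | inj₂ m≤i = trans (IsBlockSwap.high (blockSwap-isBlockSwap a b c) (≤-trans s≤m m≤i))
                           (sym (extend-≥ _ m≤i))

blockSwapFin-inverse : ∀ {m} a b c (p : a + b + c ≤ m) (q : a + c + b ≤ m) →
  ∀ i → blockSwapFin a b c p (blockSwapFin a c b q i) ≡ i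
blockSwapFin-inverse a b c p q i = toℕ-injective (trans (toℕ-blockSwapFin a b c p _)
  (trans (cong (blockSwap a b c) (toℕ-blockSwapFin a c b q i))
    (IsBlockSwap-inverse (blockSwap-isBlockSwap a b c) (blockSwap-isBlockSwap a c b) (toℕ i))))

module _ {m} a b c (p : a + b + c ≤ m) where

  private
    q : a + c + b ≤ m
    q = ≤-trans (≤-reflexive (+-right-comm a c b)) p

  blockSwapPermutation : Permutation′ m
  blockSwapPermutation = permutation (blockSwapFin a b c p) (blockSwapFin a c b q)
    (blockSwapFin-inverse a b c p q) (blockSwapFin-inverse a c b q p)

  blockSwapPermutation-isBlockSwap : IsBlockSwap a b c (apply blockSwapPermutation)
  blockSwapPermutation-isBlockSwap = extend-blockSwapFin a b c p

  blockSwapPermutation-flip-isBlockSwap : IsBlockSwap a c b (apply (flip blockSwapPermutation))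
  blockSwapPermutation-flip-isBlockSwap = extend-blockSwapFin a c b q

-- Vectors of bounded sum

-- These are the gap sequences of the `r`-element subsets of an `n`-element set. Adding `r` on the
-- left, instead of subtracting it from `n`, leaves no vectors when `n < r`.
BoundedVec : ℕ → ℕ → Set
BoundedVec n r = Σ (Vec ℕ r) λ v → sum v + r ≤ n

BoundedVec-≡ : ∀ {n r} {u v : BoundedVec n r} → proj₁ u ≡ proj₁ v → u ≡ v
BoundedVec-≡ {u = v , _} refl = cong (v ,_) (≤-irrelevant _ _)

-- A leading 0 is removed and a positive leading entry is lowered by one:
-- this is Pascal's rule.
BoundedVec-pascal : ∀ n r → BoundedVec (suc n) (suc r) ↔ (BoundedVec n r ⊎ BoundedVec n (suc r))
BoundedVec-pascal n r = mk↔ₛ′ to from to-from from-to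
  where
  to : BoundedVec (suc n) (suc r) → BoundedVec n r ⊎ BoundedVec n (suc r)
  to (zero  ∷ v , p) = inj₁ (v , ≤-pred (≤-trans (≤-reflexive (sym (+-suc (sum v) r))) p))
  to (suc x ∷ v , p) = inj₂ (x ∷ v , ≤-pred p)
  from : BoundedVec n r ⊎ BoundedVec n (suc r) → BoundedVec (suc n) (suc r)
  from (inj₁ (v , p))     = zero ∷ v , ≤-trans (≤-reflexive (+-suc (sum v) r)) (s≤s p)
  from (inj₂ (x ∷ v , p)) = suc x ∷ v , s≤s p
  to-from : ∀ y → to (from y) ≡ y
  to-from (inj₁ (v , p))     = cong inj₁ (BoundedVec-≡ refl)
  to-from (inj₂ (x ∷ v , p)) = cong inj₂ (BoundedVec-≡ refl)
  from-to : ∀ y → from (to y) ≡ y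
  from-to (zero  ∷ v , p) = BoundedVec-≡ refl
  from-to (suc x ∷ v , p) = BoundedVec-≡ refl

BoundedVec↔Fin : ∀ n r → BoundedVec n r ↔ Fin (n C r)
BoundedVec↔Fin n zero =
  ↔-trans (mk↔ₛ′ (λ _ → tt) (λ _ → [] , z≤n) (λ _ → refl) (λ { ([] , p) → BoundedVec-≡ refl }))
          (↔-sym 1↔⊤)
BoundedVec↔Fin zero (suc r) = mk↔ₛ′ (λ { (v , p) → ⊥-elim (m+1+n≢0 (sum v) (n≤0⇒n≡0 p)) })
  (λ ()) (λ ()) (λ { (v , p) → ⊥-elim (m+1+n≢0 (sum v) (n≤0⇒n≡0 p)) })
BoundedVec↔Fin (suc n) (suc r) =
  subst (λ x → BoundedVec (suc n) (suc r) ↔ Fin x) (nCk+nC[k+1]≡[n+1]C[k+1] n r)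
    (↔-trans (BoundedVec-pascal n r)
      (↔-trans (BoundedVec↔Fin n r ⊎-↔ BoundedVec↔Fin n (suc r)) (↔-sym +↔⊎)))

-- Counting by parameters

-- Injectivity of `from` makes the chosen preimages of equivalent elements equal, so the section
-- respects the setoid and inverts `from`.
section⇒HasCardinality : ∀ {c ℓ n} {A : Set} (S : Setoid c ℓ) (let open Setoid S) →
  A ↔ Fin n → (from : A → Carrier) → (∀ {x y} → from x ≈ from y → x ≡ y) →
  (∀ s → ∃[ x ] from x ≈ s) → HasCardinality S n
section⇒HasCardinality S A↔Fin from from-injective section = record
  { to        = λ s → A.to (proj₁ (section s))
  ; from      = λ i → from (A.from i)
  ; to-cong   = λ {s} {t} s≈t → cong A.to (from-injective
                  (S.trans (proj₂ (section s)) (S.trans s≈t (S.sym (proj₂ (section t))))))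
  ; from-cong = λ { refl → S.refl }
  ; inverse   = (λ {i} {s} s≈ → trans (cong A.to (from-injective (S.trans (proj₂ (section s)) s≈)))
                                      (A.strictlyInverseˡ i))
              , (λ { {s} refl → S.trans (S.reflexive (cong from (A.strictlyInverseʳ (proj₁ (section s)))))
                                        (proj₂ (section s)) })
  }
  where
  module A = Inverse A↔Fin
  module S = Setoid S

-- The summand `c + 0` is what `sum` of a vector with three entries unfolds to; the right side is
-- the end of the second block.
total-length : ∀ e a b c → (a + (b + (c + 0)) + 2) + (e + e) ≡ a + suc (e + b) + suc (e + c)
total-length = solve-∀

module _ (k e : ℕ) (e<k : e < k) where

  private
    S = BiGrassmannianAvoidingId (k + e) k
    module S = Setoid S

  total-bound : (k ∸ e) + (e + e) ≡ k + e
  total-bound = trans (sym (+-assoc (k ∸ e) e e)) (cong (_+ e) (m∸n+n≡m (<⇒≤ e<k)))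

  -- Taking one from both sides and adding `2e` turns the bound on the parameters into the bound on
  -- the end of the second block.
  fits : ∀ a b c → a + (b + (c + 0)) + 3 ≤ k ∸ e + 1 → a + suc (e + b) + suc (e + c) ≤ k + e
  fits a b c p = subst₂ _≤_ (total-length e a b c) total-bound
    (+-monoˡ-≤ (e + e) (≤-pred (subst₂ _≤_ (+-suc _ 2) (+-comm _ 1) p)))

  fits⁻¹ : ∀ a b c → a + suc (e + b) + suc (e + c) ≤ k + e → a + (b + (c + 0)) + 3 ≤ k ∸ e + 1
  fits⁻¹ a b c p = subst₂ _≤_ (sym (+-suc _ 2)) (+-comm 1 _)
    (s≤s (+-cancelʳ-≤ (e + e) _ _ (subst₂ _≤_ (sym (total-length e a b c)) (sym total-bound) p)))

  parameterSwap : ∀ a b c → a + (b + (c + 0)) + 3 ≤ k ∸ e + 1 → Permutation′ (k + e)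
  parameterSwap a b c p = blockSwapPermutation a (suc (e + b)) (suc (e + c)) (fits a b c p)

  parameterSwap-isBlockSwap : ∀ a b c p →
    IsBlockSwap a (suc (e + b)) (suc (e + c)) (apply (parameterSwap a b c p))
  parameterSwap-isBlockSwap a b c p =
    blockSwapPermutation-isBlockSwap a (suc (e + b)) (suc (e + c)) (fits a b c p)

  parameterSwap-BiGrassmannian : ∀ a b c p → BiGrassmannian (parameterSwap a b c p)
  parameterSwap-BiGrassmannian a b c p =
    blockSwap-Grassmannian π (parameterSwap-isBlockSwap a b c p) ,
    blockSwap-Grassmannian (flip π)
      (blockSwapPermutation-flip-isBlockSwap a (suc (e + b)) (suc (e + c)) (fits a b c p))
    where π = parameterSwap a b c p

  parameterSwap-AvoidsId : ∀ a b c p → AvoidsId k (parameterSwap a b c p)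
  parameterSwap-AvoidsId a b c p inc =
    [ too-long b , too-long c ]′
      (increasing⇒≤ (parameterSwap a b c p) (parameterSwap-isBlockSwap a b c p) (fits a b c p) inc)
    where
    too-long : ∀ x → ¬ k + suc (e + x) ≤ k + e
    too-long x le = m+n≮m e x (+-cancelˡ-≤ k _ _ le)

  fromParameters : BoundedVec (k ∸ e + 1) 3 → S.Carrier
  fromParameters (a ∷ b ∷ c ∷ [] , p) =
    parameterSwap a b c p , parameterSwap-BiGrassmannian a b c p , parameterSwap-AvoidsId a b c p

  fromParameters-injective : ∀ {u v} → fromParameters u S.≈ fromParameters v → u ≡ v
  fromParameters-injective {a ∷ b ∷ c ∷ [] , p} {a′ ∷ b′ ∷ c′ ∷ [] , p′} eq = BoundedVec-≡
    (cong₂ _∷_ (proj₁ equal) (cong₂ (λ x y → x ∷ y ∷ [])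
      (+-cancelˡ-≡ e _ _ (suc-injective (proj₁ (proj₂ equal))))
      (+-cancelˡ-≡ e _ _ (suc-injective (proj₂ (proj₂ equal))))))
    where
    π π′ : Permutation′ (k + e)
    π  = parameterSwap a b c p
    π′ = parameterSwap a′ b′ c′ p′
    equal : a ≡ a′ × suc (e + b) ≡ suc (e + b′) × suc (e + c) ≡ suc (e + c′)
    equal = IsBlockSwap-injective {f = apply π′} z<s z<s z<s z<s
      (IsBlockSwap-resp-≗ {f = apply π} (extend-cong eq) (parameterSwap-isBlockSwap a b c p))
      (parameterSwap-isBlockSwap a′ b′ c′ p′)

  parameters : ∀ s → ∃[ v ] fromParameters v S.≈ s
  parameters (π , bg , av) with classification π (m≤m+n k e) bg av
  ... | a , b , c , 0<b , 0<c , F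
    -- Deleting a block of length at most `e` would leave an increasing subsequence of length `k`,
    -- so both lengths are at least `1 + e`.
    with m≤n⇒∃[o]m+o≡n {suc e} {b} (≰⇒> λ b≤e → av (skip-first π F (+-monoʳ-≤ k b≤e)))
       | m≤n⇒∃[o]m+o≡n {suc e} {c} (≰⇒> λ c≤e → av (skip-second π F (+-monoʳ-≤ k c≤e)))
  ... | b′ , refl | c′ , refl = (a ∷ b′ ∷ c′ ∷ [] , p) , agree
    where
    p : a + (b′ + (c′ + 0)) + 3 ≤ k ∸ e + 1
    p = fits⁻¹ a b′ c′ (blockSwap-fits π F 0<b 0<c)
    agree : ∀ i → parameterSwap a b′ c′ p ⟨$⟩ʳ i ≡ π ⟨$⟩ʳ i
    agree i = toℕ-injective (trans (sym (extend-toℕ _ i))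
      (trans (IsBlockSwap-unique (parameterSwap-isBlockSwap a b′ c′ p) F (toℕ i)) (extend-toℕ _ i)))

theorem5p2 : (k m : ℕ) → 1 ≤ k → k ≤ m → m < 2 * k →
    HasCardinality (BiGrassmannianAvoidingId m k) ((2 * k ∸ m + 1) C 3)
theorem5p2 k m 1≤k k≤m m<2k with m≤n⇒∃[o]m+o≡n k≤m
-- With `m = k + e`, the number `2k - m` becomes `k - e` and the bound `m < 2k` becomes `e < k`.
... | e , refl = subst (λ x → HasCardinality (BiGrassmannianAvoidingId (k + e) k) ((x + 1) C 3)) (sym k∸e≡)
  (section⇒HasCardinality _ (BoundedVec↔Fin (k ∸ e + 1) 3)
    (fromParameters k e e<k) (fromParameters-injective k e e<k) (parameters k e e<k))
  where
  2k≡k+k : 2 * k ≡ k + k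
  2k≡k+k = cong (k +_) (+-identityʳ k)
  k∸e≡ : 2 * k ∸ (k + e) ≡ k ∸ e
  k∸e≡ = trans (cong (_∸ (k + e)) 2k≡k+k) ([m+n]∸[m+o]≡n∸o k k e)
  e<k : e < k
  e<k = +-cancelˡ-< k e k (<-≤-trans m<2k (≤-reflexive 2k≡k+k))
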